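{- Let $F(x)=\sum_{n\ge 1} f(n)x^n$ be a formal power series with $f(1)\neq 0$ and composita $F^{\Delta}(n,k)$ (so $F^{\Delta}(1,1)=f(1)$), and let $A(x)$ be its reverse (compositional inverse) series, i.e. the formal power series with $A(0)=0$ and $F(A(x))=x$. Then the composita of $A$ is, for $n\ge m\ge 1$, $$A^{\Delta}(n,m)=\begin{cases}\dfrac{1}{F^{\Delta}(1,1)^n}, & n=m,\\[6pt] \dfrac{m}{n\,F^{\Delta}(1,1)^n}\displaystyle\sum_{k=1}^{n-m}\binom{n+k-1}{n-1}\sum_{j=1}^{k}\frac{(-1)^j}{F^{\Delta}(1,1)^j}\binom{k}{j}F^{\Delta}(n-m+j,j), & n>m.\end{cases}$$
   Context: All generating functions are formal power series in $x$. For a power series $F(x)=\sum_{n\ge 1} f(n)x^n$ with zero constant term, its composita is the two-variable function $F^{\Delta}(n,k)$ ($n\ge k\ge 1$) defined by $F^{\Delta}(n,k)=\sum_{\lambda_1+\cdots+\lambda_k=n}f(\lambda_1)f(\lambda_2)\cdots f(\lambda_k)$, where the sum runs over all compositions of $n$ into exactly $k$ positive integer parts; equivalently $[F(x)]^k=\sum_{n\ge k}F^{\Delta}(n,k)x^n$. -}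

module Defs where

open import Algebra.Apartness.Bundles using (HeytingField; HeytingCommutativeRing)
open import Algebra.Bundles using (CommutativeRing; Semiring)
open import Data.Empty using (⊥-elim)
open import Data.Fin.Base using (toℕ)
open import Data.List.Base as List using (List; []; _∷_; upTo; concatMap)
open import Data.Nat.Base as ℕ using (ℕ; zero; suc; _∸_)
open import Data.Product.Base using (_×_; _,_; proj₁; proj₂)
open import Data.Sum.Base using (inj₁; inj₂)
open import Data.Vec.Base as Vec using (Vec; []; _∷_)
import Algebra.Definitions.RawSemiring as RawSemiringDefs
import Algebra.Properties.Ring as RingProperties

-- Compositions of n into exactly k positive parts: the first part p runs
-- over 1, …, n and the rest is a composition of n ∸ p into k ∸ 1 parts.
compositions : (n k : ℕ) → List (Vec ℕ k)
compositions zero    zero    = [] ∷ []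
compositions (suc n) zero    = []
compositions n       (suc k) =
  concatMap (λ p → List.map (p ∷_) (compositions (n ∸ p) k)) (List.map suc (upTo n))

module Series {c ℓ₁ ℓ₂} (K : HeytingField c ℓ₁ ℓ₂) where

  open HeytingField K

  commutativeRing : CommutativeRing c ℓ₁
  commutativeRing = HeytingCommutativeRing.commutativeRing heytingCommutativeRing

  open CommutativeRing commutativeRing public using (semiring; ring)

  open RawSemiringDefs (Semiring.rawSemiring semiring) public using (_^_; sum) renaming (_×_ to infixr 8 _·_)

  -- The apartness x # 0# is the constructive form of x ≠ 0.
  CharacteristicZero : Set ℓ₂
  CharacteristicZero = ∀ n → 1 ℕ.≤ n → (n · 1#) # 0#

  -- #⇒invertible yields an inverse of x - 0#; inv-inverseʳ shows that it is
  -- an inverse of x.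
  inv : (x : Carrier) → x # 0# → Carrier
  inv x x#0 = proj₁ (#⇒invertible x#0)

  x-0≈x : ∀ x → (x - 0#) ≈ x
  x-0≈x x = trans (+-congˡ (RingProperties.-0#≈0# ring)) (+-identityʳ x)

  inv-inverseʳ : ∀ x (x#0 : x # 0#) → x * inv x x#0 ≈ 1#
  inv-inverseʳ x x#0 =
    trans (*-congʳ (sym (x-0≈x x))) (proj₂ (proj₂ (#⇒invertible x#0)))

  -- ∑₁ n g = g 1 + ⋯ + g n
  ∑₁ : ℕ → (ℕ → Carrier) → Carrier
  ∑₁ n g = sum {n} (λ i → g (suc (toℕ i)))

  -- ∑₀ n g = g 0 + ⋯ + g n
  ∑₀ : ℕ → (ℕ → Carrier) → Carrier
  ∑₀ n g = sum {suc n} (λ i → g (toℕ i))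

  -- A formal power series is its sequence of coefficients.
  PowerSeries : Set c
  PowerSeries = ℕ → Carrier

  infix 4 _≋_
  _≋_ : PowerSeries → PowerSeries → Set ℓ₁
  F ≋ G = ∀ n → F n ≈ G n

  one : PowerSeries
  one zero    = 1#
  one (suc _) = 0#

  X : PowerSeries
  X zero    = 0#
  X (suc n) = one n

  infixl 7 _⊛_
  _⊛_ : PowerSeries → PowerSeries → PowerSeries
  (F ⊛ G) n = ∑₀ n (λ i → F i * G (n ∸ i))

  infixr 8 _^ˢ_
  _^ˢ_ : PowerSeries → ℕ → PowerSeries
  F ^ˢ zero  = one
  F ^ˢ suc k = F ⊛ F ^ˢ k

  -- F(A(x)) = ∑ₖ f(k) A(x)ᵏ.  Only meaningful when A(0) = 0; then A(x)ᵏ has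
  -- no terms below xᵏ, so the coefficient of xⁿ only involves k ≤ n.
  infixr 9 _⊚_
  _⊚_ : PowerSeries → PowerSeries → PowerSeries
  (F ⊚ A) n = ∑₀ n (λ k → F k * (A ^ˢ k) n)

  IsReverse : PowerSeries → PowerSeries → Set ℓ₁
  IsReverse F A = A 0 ≈ 0# × F ⊚ A ≋ X

  sumList : List Carrier → Carrier
  sumList = List.foldr _+_ 0#

  prodVec : ∀ {k} → Vec Carrier k → Carrier
  prodVec = Vec.foldr (λ _ → Carrier) _*_ 1#

  composita : PowerSeries → ℕ → ℕ → Carrier
  composita F n k = sumList (List.map (λ v → prodVec (Vec.map F v)) (compositions n k))

  composita₁₁ : ∀ F → composita F 1 1 ≈ F 1
  composita₁₁ F = trans (+-identityʳ _) (*-identityʳ _)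

  composita₁₁#0 : ∀ F → F 1 # 0# → composita F 1 1 # 0#
  composita₁₁#0 F f₁#0 with #-cotrans f₁#0 (composita F 1 1)
  ... | inj₁ f₁#c = ⊥-elim (#-irrefl (sym (composita₁₁ F)) f₁#c)
  ... | inj₂ c#0  = c#0

{-# OPTIONS --safe #-}

-- Write F = x G and let W = 1/G.  Lagrange inversion says
-- n [xⁿ] Aᵐ = m [xⁿ⁻ᵐ] Wⁿ.  Because F ∘ A = x, the functional
-- P ↦ n [xⁿ] (P ∘ A) sends Fᵏ to n [xⁿ] xᵏ.  With θ = x d/dx, the functional
-- P ↦ [xⁿ] (θP · Wⁿ) takes the same values, since
-- [xⁿ] (θ(Fᵏ) Wⁿ) = k [xʳ] (Wʳ + Wʳ⁺¹ θG) with r = n − k, and for r ≥ 1 the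
-- bracket is Wʳ − θ(Wʳ)/r, whose r-th coefficient vanishes.  The powers of F
-- separate functionals of [x⁰], …, [xⁿ], so the two agree on P = xᵐ.
-- The double sum is [xⁿ⁻ᵐ] of (F₁ W)ⁿ = (1 − E)⁻ⁿ = ∑ₖ C(n+k−1, n−1) Eᵏ, where
-- Eᵏ = (1 − G/F₁)ᵏ is expanded by the binomial theorem.
module Submission where

open import Defs
open import Algebra.Apartness.Bundles using (HeytingField)
open import Algebra.Bundles using (CommutativeRing)
open import Data.Fin.Base as Fin using (Fin; toℕ)
import Data.Fin.Properties as Fin
open import Data.List.Base as List using (List; []; _∷_; _++_; applyUpTo; concatMap)
open import Data.Nat.Base as ℕ using (ℕ; zero; suc; _∸_; _≤_; _<_; z≤n; s≤s)
open import Data.Nat.Combinatorics using (_C_; nCn≡1; nCk+nC[k+1]≡[n+1]C[k+1])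
import Data.Nat.Properties as ℕ
open import Data.Nat.Properties using (≤-trans)
open import Data.Product.Base using (_×_; _,_; proj₁)
open import Data.Sum.Base using (inj₁; inj₂)
open import Data.Vec.Base as Vec using (Vec; _∷_)
open import Function.Base using (id)
open import Relation.Binary.PropositionalEquality.Core as ≡ using (_≡_)
import Algebra.Properties.CommutativeSemiring.Binomial as Binomial
import Algebra.Properties.Ring as RingProperties
import Algebra.Properties.Semiring.Exp as SemiringExp
import Algebra.Properties.Semiring.Mult as SemiringMult
import Algebra.Properties.Semiring.Sum as SemiringSum
import Algebra.Solver.Ring.NaturalCoefficients.Default as SemiringSolver
import Relation.Binary.Reasoning.Setoid as SetoidReasoning

module SeriesAlgebra {c ℓ₁ ℓ₂} (K : HeytingField c ℓ₁ ℓ₂) where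

  open HeytingField K
  open Series K
  open CommutativeRing commutativeRing using (commutativeSemiring)
  open RingProperties ring using (+-cancelʳ; -1*x≈-x)
  open SemiringMult semiring using (×-homo-+; ×-assoc-*; ×-congʳ; ×-comm-*)
  open SemiringSum semiring using (*-distribˡ-sum; ∑-distrib-+; ∑-comm; sum-cong-≋)
  open SemiringSolver commutativeSemiring using (solve; _:=_; _:+_; _:*_; con)
  open SetoidReasoning setoid

  -- Finite sums indexed from zero.

  ∑₀-cong : ∀ n {f g : ℕ → Carrier} → (∀ i → i ≤ n → f i ≈ g i) → ∑₀ n f ≈ ∑₀ n g
  ∑₀-cong n f≈g = sum-cong-≋ (λ i → f≈g (toℕ i) (ℕ.≤-pred (Fin.toℕ<n i)))

  ∑₀-zero : ∀ n {f : ℕ → Carrier} → (∀ i → i ≤ n → f i ≈ 0#) → ∑₀ n f ≈ 0#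
  ∑₀-zero zero    f≈0 = trans (+-identityʳ _) (f≈0 0 z≤n)
  ∑₀-zero (suc n) f≈0 =
    trans (+-cong (f≈0 0 z≤n) (∑₀-zero n (λ i i≤n → f≈0 (suc i) (s≤s i≤n)))) (+-identityˡ 0#)

  ∑₀-last : ∀ n (f : ℕ → Carrier) → ∑₀ (suc n) f ≈ ∑₀ n f + f (suc n)
  ∑₀-last zero    f = solve 2 (λ a b → a :+ (b :+ con 0) := (a :+ con 0) :+ b) refl _ _
  ∑₀-last (suc n) f = trans (+-congˡ (∑₀-last n (λ i → f (suc i)))) (sym (+-assoc _ _ _))

  ∑₀-distribˡ : ∀ n x (f : ℕ → Carrier) → x * ∑₀ n f ≈ ∑₀ n (λ i → x * f i)
  ∑₀-distribˡ n x f = *-distribˡ-sum {suc n} x (λ i → f (toℕ i))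

  ∑₀-+ : ∀ n (f g : ℕ → Carrier) → ∑₀ n (λ i → f i + g i) ≈ ∑₀ n f + ∑₀ n g
  ∑₀-+ n f g = ∑-distrib-+ {suc n} (λ i → f (toℕ i)) (λ i → g (toℕ i))

  ∑₀-comm : ∀ m n (f : ℕ → ℕ → Carrier) →
            ∑₀ m (λ i → ∑₀ n (f i)) ≈ ∑₀ n (λ j → ∑₀ m (λ i → f i j))
  ∑₀-comm m n f = ∑-comm {suc m} {suc n} (λ i j → f (toℕ i) (toℕ j))

  -- The sum defining `_⊚_` is bounded by the index of the coefficient; this lowers the bound when
  -- that index drops.
  ∑₀-truncate : ∀ {l n} (f : ℕ → Carrier) → l ≤ n → (∀ i → l < i → f i ≈ 0#) → ∑₀ n f ≈ ∑₀ l f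
  ∑₀-truncate {n = zero}  f z≤n f≈0 = refl
  ∑₀-truncate {zero} {suc n} f z≤n f≈0 =
    +-congˡ (∑₀-zero n (λ i _ → f≈0 (suc i) (s≤s z≤n)))
  ∑₀-truncate {suc l} f (s≤s l≤n) f≈0 =
    +-congˡ (∑₀-truncate (λ i → f (suc i)) l≤n (λ i l<i → f≈0 (suc i) (s≤s l<i)))

  -- The commutative ring of formal power series.

  infixl 6 _⊕_
  _⊕_ : PowerSeries → PowerSeries → PowerSeries
  (F ⊕ G) n = F n + G n

  ⊖_ : PowerSeries → PowerSeries
  (⊖ F) n = - F n

  𝟘 : PowerSeries
  𝟘 _ = 0#

  infixr 7 _◃_
  _◃_ : Carrier → PowerSeries → PowerSeries
  (x ◃ F) n = x * F n

  tail : PowerSeries → PowerSeries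
  tail F n = F (suc n)

  ⊛-cong : ∀ {F F′ G G′} → F ≋ F′ → G ≋ G′ → F ⊛ G ≋ F′ ⊛ G′
  ⊛-cong F≋F′ G≋G′ n = ∑₀-cong n (λ i _ → *-cong (F≋F′ i) (G≋G′ (n ∸ i)))

  ⊛-distribʳ : ∀ H F G → (F ⊕ G) ⊛ H ≋ F ⊛ H ⊕ G ⊛ H
  ⊛-distribʳ H F G n = trans
    (∑₀-cong n (λ i _ → distribʳ (H (n ∸ i)) (F i) (G i)))
    (∑₀-+ n (λ i → F i * H (n ∸ i)) (λ i → G i * H (n ∸ i)))

  ◃-⊛ : ∀ x F G → (x ◃ F) ⊛ G ≋ x ◃ (F ⊛ G)
  ◃-⊛ x F G n = trans
    (∑₀-cong n (λ i _ → *-assoc x (F i) (G (n ∸ i))))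
    (sym (∑₀-distribˡ n x (λ i → F i * G (n ∸ i))))

  -- By computation a product splits off the head of its left factor. This is the mirror image,
  -- splitting off the head of the right factor, on which commutativity rests.
  ⊛-tailʳ : ∀ F G n → (F ⊛ G) (suc n) ≈ F (suc n) * G 0 + (F ⊛ tail G) n
  ⊛-tailʳ F G zero    =
    solve 2 (λ a b → a :+ (b :+ con 0) := b :+ (a :+ con 0)) refl _ _
  ⊛-tailʳ F G (suc n) = begin
    F 0 * G (suc (suc n)) + (tail F ⊛ G) (suc n)
      ≈⟨ +-congˡ (⊛-tailʳ (tail F) G n) ⟩
    F 0 * G (suc (suc n)) + (F (suc (suc n)) * G 0 + (tail F ⊛ tail G) n)
      ≈⟨ solve 3 (λ a b c → a :+ (b :+ c) := b :+ (a :+ c)) refl _ _ _ ⟩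
    F (suc (suc n)) * G 0 + (F 0 * G (suc (suc n)) + (tail F ⊛ tail G) n) ∎

  ⊛-comm : ∀ F G → F ⊛ G ≋ G ⊛ F
  ⊛-comm F G zero    = +-congʳ (*-comm _ _)
  ⊛-comm F G (suc n) =
    trans (+-cong (*-comm _ _) (⊛-comm (tail F) G n)) (sym (⊛-tailʳ G F n))

  ⊛-assoc : ∀ F G H → (F ⊛ G) ⊛ H ≋ F ⊛ (G ⊛ H)
  ⊛-assoc F G H zero    =
    solve 3 (λ a b c → (a :* b :+ con 0) :* c :+ con 0 := a :* (b :* c :+ con 0) :+ con 0) refl _ _ _
  ⊛-assoc F G H (suc n) = begin
    -- By computation `tail (F ⊛ G)` is `F 0 ◃ tail G ⊕ tail F ⊛ G`, so the induction can be applied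
    -- to `tail F`.
    (F 0 * G 0 + 0#) * H (suc n) + ((F 0 ◃ tail G ⊕ tail F ⊛ G) ⊛ H) n
      ≈⟨ +-congˡ (⊛-distribʳ H (F 0 ◃ tail G) (tail F ⊛ G) n) ⟩
    (F 0 * G 0 + 0#) * H (suc n) + (((F 0 ◃ tail G) ⊛ H) n + ((tail F ⊛ G) ⊛ H) n)
      ≈⟨ +-congˡ (+-cong (◃-⊛ (F 0) (tail G) H n) (⊛-assoc (tail F) G H n)) ⟩
    (F 0 * G 0 + 0#) * H (suc n) + (F 0 * (tail G ⊛ H) n + (tail F ⊛ (G ⊛ H)) n)
      ≈⟨ solve 5 (λ f g h x y → (f :* g :+ con 0) :* h :+ (f :* x :+ y) := f :* (g :* h :+ x) :+ y)
           refl _ _ _ _ _ ⟩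
    F 0 * (G 0 * H (suc n) + (tail G ⊛ H) n) + (tail F ⊛ (G ⊛ H)) n ∎

  𝟘-⊛ : ∀ F → 𝟘 ⊛ F ≋ 𝟘
  𝟘-⊛ F n = ∑₀-zero n (λ i _ → zeroˡ (F (n ∸ i)))

  one-⊛ : ∀ F → one ⊛ F ≋ F
  one-⊛ F zero    = trans (+-identityʳ _) (*-identityˡ _)
  one-⊛ F (suc n) = trans (+-cong (*-identityˡ _) (𝟘-⊛ F n)) (+-identityʳ _)

  -- Bundled so that the semiring solver and the binomial theorem apply to series as such.
  seriesRing : CommutativeRing c ℓ₁
  seriesRing = record
    { Carrier = PowerSeries
    ; _≈_ = _≋_
    ; _+_ = _⊕_
    ; _*_ = _⊛_
    ; -_ = ⊖_
    ; 0# = 𝟘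
    ; 1# = one
    ; isCommutativeRing = record
      { isRing = record
        { +-isAbelianGroup = record
          { isGroup = record
            { isMonoid = record
              { isSemigroup = record
                { isMagma = record
                  { isEquivalence = record
                    { refl = λ _ → refl
                    ; sym = λ F≋G n → sym (F≋G n)
                    ; trans = λ F≋G G≋H n → trans (F≋G n) (G≋H n)
                    }
                  ; ∙-cong = λ F≋F′ G≋G′ n → +-cong (F≋F′ n) (G≋G′ n)
                  }
                ; assoc = λ _ _ _ _ → +-assoc _ _ _
                }
              ; identity = (λ _ _ → +-identityˡ _) , (λ _ _ → +-identityʳ _)
              }
            ; inverse = (λ _ _ → -‿inverseˡ _) , (λ _ _ → -‿inverseʳ _)
            ; ⁻¹-cong = λ F≋G n → -‿cong (F≋G n)
            }
          ; comm = λ _ _ _ → +-comm _ _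
          }
        ; *-cong = ⊛-cong
        ; *-assoc = ⊛-assoc
        ; *-identity = one-⊛ , λ F n → trans (⊛-comm F one n) (one-⊛ F n)
        ; distrib = (λ F G H n → trans (⊛-comm F (G ⊕ H) n)
                      (trans (⊛-distribʳ F G H n) (+-cong (⊛-comm G F n) (⊛-comm H F n))))
                  , ⊛-distribʳ
        }
      ; *-comm = ⊛-comm
      }
    }

  module S where
    open CommutativeRing seriesRing public
    open SemiringExp (CommutativeRing.semiring seriesRing) public using (_^_)
    open SemiringMult (CommutativeRing.semiring seriesRing) public using () renaming (_×_ to infixr 8 _·_)
    open SemiringSum (CommutativeRing.semiring seriesRing) public using (sum)

  module ≋ = SetoidReasoning S.setoid

  open SemiringSolver S.commutativeSemiring using () renaming
    (solve to solveˢ; _:=_ to infix 4 _:=ˢ_; _:+_ to infixl 6 _:+ˢ_; _:*_ to infixl 7 _:*ˢ_; con to conˢ)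

  -- Scalars, powers, and shifts by powers of `X`.

  ◃-one-⊛ : ∀ x F → (x ◃ one) ⊛ F ≋ x ◃ F
  ◃-one-⊛ x F n = trans (◃-⊛ x one F n) (*-congˡ (one-⊛ F n))

  ⊛-head : ∀ F G → (F ⊛ G) 0 ≈ F 0 * G 0
  ⊛-head F G = +-identityʳ _

  ^ˢ-cong : ∀ k {F G} → F ≋ G → F ^ˢ k ≋ G ^ˢ k
  ^ˢ-cong zero    F≋G = S.refl
  ^ˢ-cong (suc k) F≋G = ⊛-cong F≋G (^ˢ-cong k F≋G)

  ^ˢ-+ : ∀ F m k → F ^ˢ (m ℕ.+ k) ≋ F ^ˢ m ⊛ F ^ˢ k
  ^ˢ-+ F zero    k = S.sym (one-⊛ (F ^ˢ k))
  ^ˢ-+ F (suc m) k =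
    S.trans (S.*-congˡ {F} (^ˢ-+ F m k)) (S.sym (⊛-assoc F (F ^ˢ m) (F ^ˢ k)))

  ⊛-^ˢ : ∀ F G k → (F ⊛ G) ^ˢ k ≋ F ^ˢ k ⊛ G ^ˢ k
  ⊛-^ˢ F G zero    = S.sym (one-⊛ one)
  ⊛-^ˢ F G (suc k) = S.trans (S.*-congˡ {F ⊛ G} (⊛-^ˢ F G k))
    (solveˢ 4 (λ f g a b → (f :*ˢ g) :*ˢ (a :*ˢ b) :=ˢ (f :*ˢ a) :*ˢ (g :*ˢ b)) S.refl F G (F ^ˢ k) (G ^ˢ k))

  one-^ˢ : ∀ k → one ^ˢ k ≋ one
  one-^ˢ zero    = S.refl
  one-^ˢ (suc k) = S.trans (one-⊛ (one ^ˢ k)) (one-^ˢ k)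

  ◃-^ˢ : ∀ x F k → (x ◃ F) ^ˢ k ≋ (x ^ k) ◃ F ^ˢ k
  ◃-^ˢ x F zero    n = sym (*-identityˡ _)
  ◃-^ˢ x F (suc k) n = begin
    ((x ◃ F) ⊛ (x ◃ F) ^ˢ k) n        ≈⟨ ◃-⊛ x F ((x ◃ F) ^ˢ k) n ⟩
    x * (F ⊛ (x ◃ F) ^ˢ k) n          ≈⟨ *-congˡ (S.*-congˡ {F} (◃-^ˢ x F k) n) ⟩
    x * (F ⊛ (x ^ k ◃ F ^ˢ k)) n      ≈⟨ *-congˡ (⊛-comm F (x ^ k ◃ F ^ˢ k) n) ⟩
    x * ((x ^ k ◃ F ^ˢ k) ⊛ F) n      ≈⟨ *-congˡ (◃-⊛ (x ^ k) (F ^ˢ k) F n) ⟩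
    x * (x ^ k * (F ^ˢ k ⊛ F) n)      ≈⟨ *-assoc _ _ _ ⟨
    x * x ^ k * (F ^ˢ k ⊛ F) n        ≈⟨ *-congˡ (⊛-comm (F ^ˢ k) F n) ⟩
    x * x ^ k * (F ⊛ F ^ˢ k) n        ∎

  ^ˢ-head : ∀ F k → (F ^ˢ k) 0 ≈ F 0 ^ k
  ^ˢ-head F zero    = refl
  ^ˢ-head F (suc k) = trans (⊛-head F (F ^ˢ k)) (*-congˡ (^ˢ-head F k))

  X⊛-suc : ∀ F n → (X ⊛ F) (suc n) ≈ F n
  X⊛-suc F n = trans (+-cong (zeroˡ _) (one-⊛ F n)) (+-identityˡ _)

  X^ˢ⊛-+ : ∀ k F n → (X ^ˢ k ⊛ F) (k ℕ.+ n) ≈ F n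
  X^ˢ⊛-+ zero    F n = one-⊛ F n
  X^ˢ⊛-+ (suc k) F n = begin
    ((X ⊛ X ^ˢ k) ⊛ F) (suc (k ℕ.+ n)) ≈⟨ ⊛-assoc X (X ^ˢ k) F (suc (k ℕ.+ n)) ⟩
    (X ⊛ (X ^ˢ k ⊛ F)) (suc (k ℕ.+ n)) ≈⟨ X⊛-suc (X ^ˢ k ⊛ F) (k ℕ.+ n) ⟩
    (X ^ˢ k ⊛ F) (k ℕ.+ n)             ≈⟨ X^ˢ⊛-+ k F n ⟩
    F n                                ∎

  X^ˢ⊛-< : ∀ k F {n} → n < k → (X ^ˢ k ⊛ F) n ≈ 0#
  X^ˢ⊛-< (suc k) F {zero} _ =
    trans (⊛-assoc X (X ^ˢ k) F 0) (trans (⊛-head X (X ^ˢ k ⊛ F)) (zeroˡ _))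
  X^ˢ⊛-< (suc k) F {suc n} (s≤s n<k) = begin
    ((X ⊛ X ^ˢ k) ⊛ F) (suc n) ≈⟨ ⊛-assoc X (X ^ˢ k) F (suc n) ⟩
    (X ⊛ (X ^ˢ k ⊛ F)) (suc n) ≈⟨ X⊛-suc (X ^ˢ k ⊛ F) n ⟩
    (X ^ˢ k ⊛ F) n             ≈⟨ X^ˢ⊛-< k F n<k ⟩
    0#                         ∎

  X⊛tail : ∀ {F} → F 0 ≈ 0# → F ≋ X ⊛ tail F
  X⊛tail {F} F₀≈0 zero    = trans F₀≈0 (sym (trans (⊛-head X (tail F)) (zeroˡ _)))
  X⊛tail {F} F₀≈0 (suc n) = sym (X⊛-suc (tail F) n)

  ^ˢ-X⊛tail : ∀ {F} → F 0 ≈ 0# → ∀ k → F ^ˢ k ≋ X ^ˢ k ⊛ tail F ^ˢ k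
  ^ˢ-X⊛tail {F} F₀≈0 k = S.trans (^ˢ-cong k (X⊛tail F₀≈0)) (⊛-^ˢ X (tail F) k)

  -- A series without constant term is divisible by x, so its k-th power is divisible by xᵏ. This
  -- justifies cutting off the sum in `_⊚_`.
  ^ˢ-< : ∀ {F} → F 0 ≈ 0# → ∀ {n k} → n < k → (F ^ˢ k) n ≈ 0#
  ^ˢ-< {F} F₀≈0 {n} {k} n<k = trans (^ˢ-X⊛tail F₀≈0 k n) (X^ˢ⊛-< k (tail F ^ˢ k) n<k)

  ^ˢ-+-coefficient : ∀ {F} → F 0 ≈ 0# → ∀ k n → (F ^ˢ k) (k ℕ.+ n) ≈ (tail F ^ˢ k) n
  ^ˢ-+-coefficient {F} F₀≈0 k n =
    trans (^ˢ-X⊛tail F₀≈0 k (k ℕ.+ n)) (X^ˢ⊛-+ k (tail F ^ˢ k) n)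

  -- Composition with a series without constant term is a ring homomorphism.

  ⊚-congʳ : ∀ A {P Q} → P ≋ Q → P ⊚ A ≋ Q ⊚ A
  ⊚-congʳ A P≋Q n = ∑₀-cong n (λ k _ → *-congʳ {(A ^ˢ k) n} (P≋Q k))

  ⊚-⊕ : ∀ A P Q → (P ⊕ Q) ⊚ A ≋ P ⊚ A ⊕ Q ⊚ A
  ⊚-⊕ A P Q n = trans
    (∑₀-cong n (λ k _ → distribʳ ((A ^ˢ k) n) (P k) (Q k)))
    (∑₀-+ n (λ k → P k * (A ^ˢ k) n) (λ k → Q k * (A ^ˢ k) n))

  ◃-⊚ : ∀ A x P → (x ◃ P) ⊚ A ≋ x ◃ (P ⊚ A)
  ◃-⊚ A x P n = trans
    (∑₀-cong n (λ k _ → *-assoc x (P k) ((A ^ˢ k) n)))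
    (sym (∑₀-distribˡ n x (λ k → P k * (A ^ˢ k) n)))

  module _ {A : PowerSeries} (A₀≈0 : A 0 ≈ 0#) where

    ⊛-suc : ∀ F n → (A ⊛ F) (suc n) ≈ (tail A ⊛ F) n
    ⊛-suc F n = trans (+-congʳ (trans (*-congʳ A₀≈0) (zeroˡ _))) (+-identityˡ _)

    ⊛-head≈0 : ∀ F → (A ⊛ F) 0 ≈ 0#
    ⊛-head≈0 F = trans (⊛-head A F) (trans (*-congʳ A₀≈0) (zeroˡ _))

    -- The coefficient of xⁿ in A F meets F n only through the factor A 0, which vanishes; this
    -- permits induction on the index of the coefficient.
    ⊛-cong-< : ∀ {F G} n → (∀ i → i < n → F i ≈ G i) → (A ⊛ F) n ≈ (A ⊛ G) n
    ⊛-cong-< {F} {G} zero    F≈G = trans (⊛-head≈0 F) (sym (⊛-head≈0 G))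
    ⊛-cong-< {F} {G} (suc n) F≈G = begin
      (A ⊛ F) (suc n)  ≈⟨ ⊛-suc F n ⟩
      (tail A ⊛ F) n   ≈⟨ ∑₀-cong n (λ i _ → *-congˡ {A (suc i)} (F≈G (n ∸ i) (s≤s (ℕ.m∸n≤m n i)))) ⟩
      (tail A ⊛ G) n   ≈⟨ ⊛-suc G n ⟨
      (A ⊛ G) (suc n)  ∎

    -- Horner's rule P(A) = p₀ + A (tail P)(A): one factor A is taken out of each positive power and
    -- the two finite sums are exchanged.
    ⊚-horner : ∀ P → P ⊚ A ≋ (P 0 ◃ one) ⊕ A ⊛ (tail P ⊚ A)
    ⊚-horner P zero    = +-congˡ (sym (⊛-head≈0 (tail P ⊚ A)))
    ⊚-horner P (suc n) = +-congˡ (begin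
      ∑₀ n (λ k → P (suc k) * (A ⊛ A ^ˢ k) (suc n))
        ≈⟨ ∑₀-cong n (λ k _ → *-congˡ {P (suc k)} (⊛-suc (A ^ˢ k) n)) ⟩
      ∑₀ n (λ k → P (suc k) * ∑₀ n (λ i → A (suc i) * (A ^ˢ k) (n ∸ i)))
        ≈⟨ ∑₀-cong n (λ k _ → ∑₀-distribˡ n (P (suc k)) (λ i → A (suc i) * (A ^ˢ k) (n ∸ i))) ⟩
      ∑₀ n (λ k → ∑₀ n (λ i → P (suc k) * (A (suc i) * (A ^ˢ k) (n ∸ i))))
        ≈⟨ ∑₀-comm n n (λ k i → P (suc k) * (A (suc i) * (A ^ˢ k) (n ∸ i))) ⟩
      ∑₀ n (λ i → ∑₀ n (λ k → P (suc k) * (A (suc i) * (A ^ˢ k) (n ∸ i))))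
        ≈⟨ ∑₀-cong n (λ i _ → pull i) ⟩
      ∑₀ n (λ i → A (suc i) * (tail P ⊚ A) (n ∸ i))
        ≈⟨ ⊛-suc (tail P ⊚ A) n ⟨
      (A ⊛ (tail P ⊚ A)) (suc n) ∎)
      where
      pull : ∀ i → ∑₀ n (λ k → P (suc k) * (A (suc i) * (A ^ˢ k) (n ∸ i))) ≈
                   A (suc i) * (tail P ⊚ A) (n ∸ i)
      pull i = begin
        ∑₀ n (λ k → P (suc k) * (A (suc i) * (A ^ˢ k) (n ∸ i)))
          ≈⟨ ∑₀-cong n (λ k _ → solve 3 (λ p a q → p :* (a :* q) := a :* (p :* q)) refl
               (P (suc k)) (A (suc i)) ((A ^ˢ k) (n ∸ i))) ⟩
        ∑₀ n (λ k → A (suc i) * (P (suc k) * (A ^ˢ k) (n ∸ i)))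
          ≈⟨ ∑₀-distribˡ n (A (suc i)) (λ k → P (suc k) * (A ^ˢ k) (n ∸ i)) ⟨
        A (suc i) * ∑₀ n (λ k → P (suc k) * (A ^ˢ k) (n ∸ i))
          -- The coefficient of index n ∸ i of the composition stops at k = n ∸ i; beyond that bound
          -- Aᵏ has no such coefficient.
          ≈⟨ *-congˡ (∑₀-truncate (λ k → P (suc k) * (A ^ˢ k) (n ∸ i)) (ℕ.m∸n≤m n i)
               (λ k lt → trans (*-congˡ (^ˢ-< A₀≈0 lt)) (zeroʳ _))) ⟩
        A (suc i) * (tail P ⊚ A) (n ∸ i) ∎

    one-⊚ : one ⊚ A ≋ one
    one-⊚ n = begin
      (one ⊚ A) n                       ≈⟨ ⊚-horner one n ⟩
      1# * one n + (A ⊛ (𝟘 ⊚ A)) n      ≈⟨ +-cong (*-identityˡ _) (⊛-cong-< {𝟘 ⊚ A} {𝟘} n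
                                             (λ i _ → ∑₀-zero i (λ k _ → zeroˡ ((A ^ˢ k) i)))) ⟩
      one n + (A ⊛ 𝟘) n                 ≈⟨ +-congˡ (S.zeroʳ A n) ⟩
      one n + 0#                        ≈⟨ +-identityʳ _ ⟩
      one n                             ∎

    -- Since A 0 ≈ 0#, the n-th coefficient of A ⊛ Z only involves Z below n: strong induction on n.
    ⊚-⊛-< : ∀ Q N n → n < N → ∀ P → ((P ⊛ Q) ⊚ A) n ≈ ((P ⊚ A) ⊛ (Q ⊚ A)) n
    ⊚-⊛-< Q (suc N) n (s≤s n≤N) P = begin
      ((P ⊛ Q) ⊚ A) n
        ≈⟨ ⊚-horner (P ⊛ Q) n ⟩
      (P ⊛ Q) 0 * one n + (A ⊛ (tail (P ⊛ Q) ⊚ A)) n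
        ≈⟨ +-cong (*-congʳ (⊛-head P Q)) (⊛-cong-< n step) ⟩
      P 0 * Q 0 * one n + (A ⊛ (p ⊛ s ⊕ t ⊛ z)) n
        ≈⟨ +-congʳ (trans (*-assoc _ _ _) (sym (◃-one-⊛ (P 0) q n))) ⟩
      (p ⊛ q ⊕ A ⊛ (p ⊛ s ⊕ t ⊛ z)) n
        -- The regrouping exposes `q ⊕ A ⊛ s` and `p ⊕ A ⊛ t`, the Horner forms of `Q ⊚ A` and
        -- `P ⊚ A`.
        ≈⟨ solveˢ 6 (λ p q s t z a →
              p :*ˢ q :+ˢ a :*ˢ (p :*ˢ s :+ˢ t :*ˢ z) :=ˢ p :*ˢ (q :+ˢ a :*ˢ s) :+ˢ (a :*ˢ t) :*ˢ z)
              S.refl p q s t z A n ⟩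
      (p ⊛ (q ⊕ A ⊛ s) ⊕ (A ⊛ t) ⊛ z) n
        ≈⟨ +-congʳ (S.*-congˡ {p} (⊚-horner Q) n) ⟨
      (p ⊛ z ⊕ (A ⊛ t) ⊛ z) n
        ≈⟨ S.distribʳ z p (A ⊛ t) n ⟨
      ((p ⊕ A ⊛ t) ⊛ z) n
        ≈⟨ S.*-congʳ {z} (⊚-horner P) n ⟨
      ((P ⊚ A) ⊛ (Q ⊚ A)) n ∎
      where
      p = P 0 ◃ one
      q = Q 0 ◃ one
      s = tail Q ⊚ A
      t = tail P ⊚ A
      z = Q ⊚ A
      -- The tail of P Q is a scalar multiple of `tail Q` plus the product of `tail P` with the same
      -- `Q`; hence the induction keeps `Q` fixed and varies `P`.
      step : ∀ i → i < n → (tail (P ⊛ Q) ⊚ A) i ≈ (p ⊛ s ⊕ t ⊛ z) i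
      step i i<n = begin
        ((P 0 ◃ tail Q ⊕ tail P ⊛ Q) ⊚ A) i
          ≈⟨ ⊚-⊕ A (P 0 ◃ tail Q) (tail P ⊛ Q) i ⟩
        ((P 0 ◃ tail Q) ⊚ A) i + ((tail P ⊛ Q) ⊚ A) i
          ≈⟨ +-cong (◃-⊚ A (P 0) (tail Q) i) (⊚-⊛-< Q N i (ℕ.<-≤-trans i<n n≤N) (tail P)) ⟩
        P 0 * s i + (t ⊛ z) i
          ≈⟨ +-congʳ (◃-one-⊛ (P 0) s i) ⟨
        (p ⊛ s ⊕ t ⊛ z) i ∎

    ⊚-⊛ : ∀ P Q → (P ⊛ Q) ⊚ A ≋ (P ⊚ A) ⊛ (Q ⊚ A)
    ⊚-⊛ P Q n = ⊚-⊛-< Q (suc n) n ℕ.≤-refl P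

    ⊚-^ˢ : ∀ P k → (P ^ˢ k) ⊚ A ≋ (P ⊚ A) ^ˢ k
    ⊚-^ˢ P zero    = one-⊚
    ⊚-^ˢ P (suc k) = S.trans (⊚-⊛ P (P ^ˢ k)) (S.*-congˡ {P ⊚ A} (⊚-^ˢ P k))

  -- Cancellation, and separation of functionals by the powers of a series.

  *-cancelʳ-invertible : ∀ {a b x y} → a * b ≈ 1# → x * a ≈ y * a → x ≈ y
  *-cancelʳ-invertible {a} {b} {x} {y} ab≈1 xa≈ya = begin
    x           ≈⟨ trans (*-congˡ ab≈1) (*-identityʳ x) ⟨
    x * (a * b) ≈⟨ *-assoc x a b ⟨
    x * a * b   ≈⟨ *-congʳ xa≈ya ⟩
    y * a * b   ≈⟨ *-assoc y a b ⟩
    y * (a * b) ≈⟨ trans (*-congˡ ab≈1) (*-identityʳ y) ⟩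
    y           ∎

  ^-inverse : ∀ {a b} → a * b ≈ 1# → ∀ k → a ^ k * b ^ k ≈ 1#
  ^-inverse {a} {b} ab≈1 zero    = *-identityˡ 1#
  ^-inverse {a} {b} ab≈1 (suc k) = begin
    a * a ^ k * (b * b ^ k)
      ≈⟨ solve 4 (λ a x b y → (a :* x) :* (b :* y) := (a :* b) :* (x :* y)) refl a (a ^ k) b (b ^ k) ⟩
    a * b * (a ^ k * b ^ k)
      ≈⟨ *-cong ab≈1 (^-inverse ab≈1 k) ⟩
    1# * 1#
      ≈⟨ *-identityˡ 1# ⟩
    1# ∎

  -- The matrix of coefficients (F ^ˢ k) j is triangular with invertible diagonal.
  powers-separate : ∀ {F u} → F 0 ≈ 0# → F 1 * u ≈ 1# → ∀ n {x y : ℕ → Carrier} →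
    (∀ k → k ≤ n → ∑₀ n (λ j → x j * (F ^ˢ k) j) ≈ ∑₀ n (λ j → y j * (F ^ˢ k) j)) →
    ∀ j → j ≤ n → x j ≈ y j
  powers-separate {F} {u} F₀≈0 F₁u≈1 = separate
    where
    diagonal : ∀ n → (F ^ˢ n) n ≈ F 1 ^ n
    diagonal n = begin
      (F ^ˢ n) n           ≡⟨ ≡.cong (F ^ˢ n) (ℕ.+-identityʳ n) ⟨
      (F ^ˢ n) (n ℕ.+ 0)   ≈⟨ ^ˢ-+-coefficient F₀≈0 n 0 ⟩
      (tail F ^ˢ n) 0      ≈⟨ ^ˢ-head (tail F) n ⟩
      F 1 ^ n              ∎

    top-row : ∀ n (x : ℕ → Carrier) → ∑₀ n (λ j → x j * (F ^ˢ n) j) ≈ x n * F 1 ^ n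
    top-row zero    x = +-identityʳ _
    top-row (suc n) x = begin
      ∑₀ (suc n) (λ j → x j * (F ^ˢ suc n) j)
        ≈⟨ ∑₀-last n (λ j → x j * (F ^ˢ suc n) j) ⟩
      ∑₀ n (λ j → x j * (F ^ˢ suc n) j) + x (suc n) * (F ^ˢ suc n) (suc n)
        ≈⟨ +-cong (∑₀-zero n (λ j j≤n → trans (*-congˡ {x j} (^ˢ-< {F} F₀≈0 (s≤s j≤n))) (zeroʳ (x j))))
                  (*-congˡ (diagonal (suc n))) ⟩
      0# + x (suc n) * F 1 ^ suc n
        ≈⟨ +-identityˡ _ ⟩
      x (suc n) * F 1 ^ suc n ∎

    top : ∀ n {x y : ℕ → Carrier} →
      ∑₀ n (λ j → x j * (F ^ˢ n) j) ≈ ∑₀ n (λ j → y j * (F ^ˢ n) j) → x n ≈ y n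
    top n {x} {y} eq = *-cancelʳ-invertible (^-inverse F₁u≈1 n)
      (trans (sym (top-row n x)) (trans eq (top-row n y)))

    separate : ∀ n {x y : ℕ → Carrier} →
      (∀ k → k ≤ n → ∑₀ n (λ j → x j * (F ^ˢ k) j) ≈ ∑₀ n (λ j → y j * (F ^ˢ k) j)) →
      ∀ j → j ≤ n → x j ≈ y j
    separate zero    {x} {y} eq zero z≤n = top 0 {x} {y} (eq 0 z≤n)
    separate (suc n) {x} {y} eq j j≤1+n with ℕ.m≤n⇒m<n∨m≡n j≤1+n
    ... | inj₂ ≡.refl    = top (suc n) {x} {y} (eq (suc n) ℕ.≤-refl)
    ... | inj₁ (s≤s j≤n) = separate n {x} {y} eq′ j j≤n
      where
      eq′ : ∀ k → k ≤ n → ∑₀ n (λ j → x j * (F ^ˢ k) j) ≈ ∑₀ n (λ j → y j * (F ^ˢ k) j)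
      -- The unknowns at `suc n` already agree by the last row, so the last column cancels and a
      -- system of size n remains.
      eq′ k k≤n = +-cancelʳ (y (suc n) * (F ^ˢ k) (suc n)) _ _ (begin
        ∑₀ n (λ j → x j * (F ^ˢ k) j) + y (suc n) * (F ^ˢ k) (suc n)
          ≈⟨ +-congˡ (*-congʳ (top (suc n) {x} {y} (eq (suc n) ℕ.≤-refl))) ⟨
        ∑₀ n (λ j → x j * (F ^ˢ k) j) + x (suc n) * (F ^ˢ k) (suc n)
          ≈⟨ ∑₀-last n (λ j → x j * (F ^ˢ k) j) ⟨
        ∑₀ (suc n) (λ j → x j * (F ^ˢ k) j)
          ≈⟨ eq k (ℕ.m≤n⇒m≤1+n k≤n) ⟩
        ∑₀ (suc n) (λ j → y j * (F ^ˢ k) j)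
          ≈⟨ ∑₀-last n (λ j → y j * (F ^ˢ k) j) ⟩
        ∑₀ n (λ j → y j * (F ^ˢ k) j) + y (suc n) * (F ^ˢ k) (suc n) ∎)

  -- The derivation θ on power series.

  -- θ = x d/dx
  θ : PowerSeries → PowerSeries
  θ F n = n · 1# * F n

  θ-cong : ∀ {F G} → F ≋ G → θ F ≋ θ G
  θ-cong F≋G n = *-congˡ (F≋G n)

  θ-one : θ one ≋ 𝟘
  θ-one zero    = zeroˡ 1#
  θ-one (suc n) = zeroʳ _

  -- Leibniz rule, term by term: the weight n is split as i + (n ∸ i) between the two factors.
  θ-⊛ : ∀ F G → θ (F ⊛ G) ≋ θ F ⊛ G ⊕ F ⊛ θ G
  θ-⊛ F G n = begin
    n · 1# * ∑₀ n (λ i → F i * G (n ∸ i))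
      ≈⟨ ∑₀-distribˡ n (n · 1#) (λ i → F i * G (n ∸ i)) ⟩
    ∑₀ n (λ i → n · 1# * (F i * G (n ∸ i)))
      ≈⟨ ∑₀-cong n leibniz ⟩
    ∑₀ n (λ i → θ F i * G (n ∸ i) + F i * θ G (n ∸ i))
      ≈⟨ ∑₀-+ n (λ i → θ F i * G (n ∸ i)) (λ i → F i * θ G (n ∸ i)) ⟩
    (θ F ⊛ G) n + (F ⊛ θ G) n ∎
    where
    leibniz : ∀ i → i ≤ n → n · 1# * (F i * G (n ∸ i)) ≈ θ F i * G (n ∸ i) + F i * θ G (n ∸ i)
    leibniz i i≤n = begin
      n · 1# * (F i * G (n ∸ i))
        ≡⟨ ≡.cong (λ k → k · 1# * (F i * G (n ∸ i))) (ℕ.m+[n∸m]≡n i≤n) ⟨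
      (i ℕ.+ (n ∸ i)) · 1# * (F i * G (n ∸ i))
        ≈⟨ *-congʳ (×-homo-+ 1# i (n ∸ i)) ⟩
      (i · 1# + (n ∸ i) · 1#) * (F i * G (n ∸ i))
        ≈⟨ solve 4 (λ a b f g → (a :+ b) :* (f :* g) := (a :* f) :* g :+ f :* (b :* g)) refl
             (i · 1#) ((n ∸ i) · 1#) (F i) (G (n ∸ i)) ⟩
      θ F i * G (n ∸ i) + F i * θ G (n ∸ i) ∎

  θ-^ˢ : ∀ F k → θ (F ^ˢ suc k) ≋ suc k · 1# ◃ (F ^ˢ k ⊛ θ F)
  θ-^ˢ F zero n = begin
    θ (F ⊛ one) n          ≈⟨ θ-cong {F ⊛ one} (S.*-identityʳ F) n ⟩
    θ F n                  ≈⟨ one-⊛ (θ F) n ⟨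
    (one ⊛ θ F) n          ≈⟨ trans (*-congʳ (+-identityʳ 1#)) (*-identityˡ _) ⟨
    1 · 1# * (one ⊛ θ F) n ∎
  θ-^ˢ F (suc k) n = begin
    θ (F ⊛ F ^ˢ suc k) n
      ≈⟨ θ-⊛ F (F ^ˢ suc k) n ⟩
    (θ F ⊛ F ^ˢ suc k) n + (F ⊛ θ (F ^ˢ suc k)) n
      ≈⟨ +-cong (⊛-comm (θ F) (F ^ˢ suc k) n) (S.*-congˡ {F} (θ-^ˢ F k) n) ⟩
    (F ^ˢ suc k ⊛ θ F) n + (F ⊛ (a ◃ (F ^ˢ k ⊛ θ F))) n
      ≈⟨ +-congˡ (trans (⊛-comm F (a ◃ (F ^ˢ k ⊛ θ F)) n) (◃-⊛ a (F ^ˢ k ⊛ θ F) F n)) ⟩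
    (F ^ˢ suc k ⊛ θ F) n + a * ((F ^ˢ k ⊛ θ F) ⊛ F) n
      ≈⟨ +-congˡ (*-congˡ (trans (⊛-comm (F ^ˢ k ⊛ θ F) F n) (sym (⊛-assoc F (F ^ˢ k) (θ F) n)))) ⟩
    (F ^ˢ suc k ⊛ θ F) n + a * (F ^ˢ suc k ⊛ θ F) n
      ≈⟨ solve 2 (λ x a → x :+ a :* x := (con 1 :+ a) :* x) refl ((F ^ˢ suc k ⊛ θ F) n) a ⟩
    (1# + a) * (F ^ˢ suc k ⊛ θ F) n ∎
    where a = suc k · 1#

  -- For a series x G this exhibits the factor x of θ(x G), so that xᵏ⁺¹ can be pulled out of (x G)ᵏ
  -- θ(x G).
  θ-X⊛ : ∀ F → θ (X ⊛ F) ≋ X ⊛ (F ⊕ θ F)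
  θ-X⊛ F n = begin
    θ (X ⊛ F) n                 ≈⟨ θ-⊛ X F n ⟩
    (θ X ⊛ F) n + (X ⊛ θ F) n   ≈⟨ +-congʳ (S.*-congʳ {F} θ-X n) ⟩
    (X ⊛ F) n + (X ⊛ θ F) n     ≈⟨ S.distribˡ X F (θ F) n ⟨
    (X ⊛ (F ⊕ θ F)) n           ∎
    where
    θ-X : θ X ≋ X
    θ-X zero          = zeroʳ _
    θ-X (suc zero)    = trans (*-identityʳ _) (+-identityʳ 1#)
    θ-X (suc (suc n)) = zeroʳ _

  -- Lagrange inversion.

  module Lagrange (char0 : CharacteristicZero) {F : PowerSeries} (F₀≈0 : F 0 ≈ 0#)
                  {W : PowerSeries} (WG≋1 : W ⊛ tail F ≋ one) where

    private
      G : PowerSeries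
      G = tail F

    -- Applying θ to W G = 1 and multiplying by W gives θW = - W² θG, written here without a minus
    -- sign so that the semiring solver suffices.
    θ-inverse : W ⊛ (W ⊛ θ G) ⊕ θ W ≋ 𝟘
    θ-inverse = ≋.begin
      W ⊛ (W ⊛ θ G) ⊕ θ W
        ≋.≈⟨ S.+-congˡ {W ⊛ (W ⊛ θ G)} (S.trans (S.*-congˡ {θ W} WG≋1) (S.*-identityʳ (θ W))) ⟨
      W ⊛ (W ⊛ θ G) ⊕ θ W ⊛ (W ⊛ G)
        ≋.≈⟨ solveˢ 4 (λ w g v h → w :*ˢ (w :*ˢ h) :+ˢ v :*ˢ (w :*ˢ g) :=ˢ w :*ˢ (v :*ˢ g :+ˢ w :*ˢ h))
              S.refl W G (θ W) (θ G) ⟩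
      W ⊛ (θ W ⊛ G ⊕ W ⊛ θ G)
        ≋.≈⟨ S.*-congˡ {W} (θ-⊛ W G) ⟨
      W ⊛ θ (W ⊛ G)
        ≋.≈⟨ S.*-congˡ {W} (S.trans (θ-cong {W ⊛ G} WG≋1) θ-one) ⟩
      W ⊛ 𝟘
        ≋.≈⟨ S.zeroʳ W ⟩
      𝟘 ≋.∎

    -- For r ≥ 1 the series is W ^ r − θ (W ^ r) / r.
    residue : ∀ r → (W ^ˢ r ⊛ (one ⊕ W ⊛ θ G)) r ≈ one r
    residue zero = begin
      (one ⊛ (one ⊕ W ⊛ θ G)) 0  ≈⟨ one-⊛ (one ⊕ W ⊛ θ G) 0 ⟩
      1# + (W ⊛ θ G) 0           ≈⟨ +-congˡ (trans (⊛-head W (θ G)) (trans (*-congˡ (zeroˡ _)) (zeroʳ _))) ⟩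
      1# + 0#                    ≈⟨ +-identityʳ 1# ⟩
      1#                         ∎
    residue (suc r) = begin
      (W ^ˢ suc r ⊛ (one ⊕ W ⊛ θ G)) (suc r)
        ≈⟨ solveˢ 3 (λ w p t → (w :*ˢ p) :*ˢ (conˢ 1 :+ˢ t) :=ˢ w :*ˢ p :+ˢ p :*ˢ (w :*ˢ t))
             S.refl W (W ^ˢ r) (W ⊛ θ G) (suc r) ⟩
      (W ^ˢ suc r) (suc r) + (W ^ˢ r ⊛ (W ⊛ (W ⊛ θ G))) (suc r)
        ≈⟨ +-congʳ diagonal ⟩
      (W ^ˢ r ⊛ θ W) (suc r) + (W ^ˢ r ⊛ (W ⊛ (W ⊛ θ G))) (suc r)
        ≈⟨ solveˢ 3 (λ p v t → p :*ˢ v :+ˢ p :*ˢ t :=ˢ p :*ˢ (t :+ˢ v))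
             S.refl (W ^ˢ r) (θ W) (W ⊛ (W ⊛ θ G)) (suc r) ⟩
      (W ^ˢ r ⊛ (W ⊛ (W ⊛ θ G) ⊕ θ W)) (suc r)
        ≈⟨ S.*-congˡ {W ^ˢ r} θ-inverse (suc r) ⟩
      (W ^ˢ r ⊛ 𝟘) (suc r)
        ≈⟨ S.zeroʳ (W ^ˢ r) (suc r) ⟩
      0# ∎
      where
      diagonal : (W ^ˢ suc r) (suc r) ≈ (W ^ˢ r ⊛ θ W) (suc r)
      -- The coefficient of xʳ⁺¹ in θ(Wʳ⁺¹) is r + 1 times that of Wʳ⁺¹, and by the power rule r + 1
      -- times that of Wʳ θW. Characteristic zero allows r + 1 to be cancelled.
      diagonal = *-cancelʳ-invertible (inv-inverseʳ (suc r · 1#) (char0 (suc r) (s≤s z≤n)))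
        (trans (*-comm _ _) (trans (θ-^ˢ W r (suc r)) (*-comm _ _)))

    -- With n = k + r, `one r` is the coefficient of xⁿ in xᵏ, so the right side is the value n [xⁿ]
    -- xᵏ of the other functional. Writing n as a sum lets the factor xᵏ be removed by a shift,
    -- which leaves `residue`.
    θ-power-residue : ∀ k r → (θ (F ^ˢ k) ⊛ W ^ˢ (k ℕ.+ r)) (k ℕ.+ r) ≈ (k ℕ.+ r) · 1# * one r
    θ-power-residue zero r = trans (S.*-congʳ {W ^ˢ r} θ-one r)
      (trans (𝟘-⊛ (W ^ˢ r) r) (sym (θ-one r)))
    θ-power-residue (suc k) r = begin
      (θ (F ^ˢ suc k) ⊛ Wⁿ) n               ≈⟨ S.*-congʳ {Wⁿ} (θ-^ˢ F k) n ⟩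
      ((suc k · 1# ◃ (F ^ˢ k ⊛ θ F)) ⊛ Wⁿ) n ≈⟨ ◃-⊛ (suc k · 1#) (F ^ˢ k ⊛ θ F) Wⁿ n ⟩
      suc k · 1# * ((F ^ˢ k ⊛ θ F) ⊛ Wⁿ) n   ≈⟨ *-congˡ (reduce n) ⟩
      suc k · 1# * (X ^ˢ suc k ⊛ (W ^ˢ r ⊛ (one ⊕ W ⊛ θ G))) n
                                             ≈⟨ *-congˡ (X^ˢ⊛-+ (suc k) (W ^ˢ r ⊛ (one ⊕ W ⊛ θ G)) r) ⟩
      suc k · 1# * (W ^ˢ r ⊛ (one ⊕ W ⊛ θ G)) r
                                             ≈⟨ *-congˡ (residue r) ⟩
      suc k · 1# * one r                     ≈⟨ scale r ⟩
      n · 1# * one r                         ∎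
      where
      n = suc k ℕ.+ r
      Wⁿ = W ^ˢ n

      -- The multipliers k + 1 and n agree when r = 0; for positive r both sides vanish.
      scale : ∀ r → suc k · 1# * one r ≈ (suc k ℕ.+ r) · 1# * one r
      scale zero    = reflexive (≡.cong (λ i → suc i · 1# * 1#) (≡.sym (ℕ.+-identityʳ k)))
      scale (suc r) = trans (zeroʳ _) (sym (zeroʳ _))

      -- Of the k + 1 + r factors W, k cancel Gᵏ, one turns G + θG into 1 + W θG, and r remain. The
      -- power of X collects k factors from Fᵏ and one from θF.
      reduce : (F ^ˢ k ⊛ θ F) ⊛ Wⁿ ≋ X ^ˢ suc k ⊛ (W ^ˢ r ⊛ (one ⊕ W ⊛ θ G))
      reduce = ≋.begin
        (F ^ˢ k ⊛ θ F) ⊛ (W ⊛ W ^ˢ (k ℕ.+ r))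
          ≋.≈⟨ ⊛-cong (⊛-cong (^ˢ-X⊛tail F₀≈0 k) (S.trans (θ-cong {F} (X⊛tail F₀≈0)) (θ-X⊛ G)))
                      (S.*-congˡ {W} (^ˢ-+ W k r)) ⟩
        ((X ^ˢ k ⊛ G ^ˢ k) ⊛ (X ⊛ (G ⊕ θ G))) ⊛ (W ⊛ (W ^ˢ k ⊛ W ^ˢ r))
          ≋.≈⟨ solveˢ 8 (λ xk gk x g h w wk wr →
                 ((xk :*ˢ gk) :*ˢ (x :*ˢ (g :+ˢ h))) :*ˢ (w :*ˢ (wk :*ˢ wr)) :=ˢ
                 (x :*ˢ xk) :*ˢ ((wk :*ˢ gk) :*ˢ (wr :*ˢ (w :*ˢ g :+ˢ w :*ˢ h))))
               S.refl (X ^ˢ k) (G ^ˢ k) X G (θ G) W (W ^ˢ k) (W ^ˢ r) ⟩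
        X ^ˢ suc k ⊛ ((W ^ˢ k ⊛ G ^ˢ k) ⊛ (W ^ˢ r ⊛ (W ⊛ G ⊕ W ⊛ θ G)))
          ≋.≈⟨ S.*-congˡ {X ^ˢ suc k} (⊛-cong
                 (S.trans (S.sym (⊛-^ˢ W G k)) (S.trans (^ˢ-cong k WG≋1) (one-^ˢ k)))
                 (S.*-congˡ {W ^ˢ r} (S.+-congʳ {W ⊛ θ G} WG≋1))) ⟩
        X ^ˢ suc k ⊛ (one ⊛ (W ^ˢ r ⊛ (one ⊕ W ⊛ θ G)))
          ≋.≈⟨ S.*-congˡ {X ^ˢ suc k} (one-⊛ (W ^ˢ r ⊛ (one ⊕ W ⊛ θ G))) ⟩
        X ^ˢ suc k ⊛ (W ^ˢ r ⊛ (one ⊕ W ⊛ θ G)) ≋.∎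

    F₁W₀≈1 : F 1 * W 0 ≈ 1#
    F₁W₀≈1 = trans (*-comm _ _) (trans (sym (⊛-head W G)) (WG≋1 0))

    lagrange-inversion : ∀ {A} → IsReverse F A → ∀ {n m} → m ≤ n →
      n · 1# * (A ^ˢ m) n ≈ m · 1# * (W ^ˢ n) (n ∸ m)
    lagrange-inversion {A} (A₀≈0 , FA≋X) {n} {m} m≤n =
      -- The two sequences list the values of the two functionals on xʲ; row k of the system
      -- compares their values on Fᵏ. The conclusion is read off at j = m.
      powers-separate F₀≈0 F₁W₀≈1 n
        {λ j → n · 1# * (A ^ˢ j) n} {λ j → j · 1# * (W ^ˢ n) (n ∸ j)} rows m m≤n
      where
      rows : ∀ k → k ≤ n → ∑₀ n (λ j → n · 1# * (A ^ˢ j) n * (F ^ˢ k) j) ≈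
                           ∑₀ n (λ j → j · 1# * (W ^ˢ n) (n ∸ j) * (F ^ˢ k) j)
      rows k k≤n with ℕ.m≤n⇒∃[o]m+o≡n k≤n
      ... | r , ≡.refl = begin
        ∑₀ n (λ j → n · 1# * (A ^ˢ j) n * (F ^ˢ k) j)
          ≈⟨ ∑₀-cong n (λ j _ → solve 3 (λ a b c → a :* b :* c := a :* (c :* b)) refl
               (n · 1#) ((A ^ˢ j) n) ((F ^ˢ k) j)) ⟩
        ∑₀ n (λ j → n · 1# * ((F ^ˢ k) j * (A ^ˢ j) n))
          ≈⟨ ∑₀-distribˡ n (n · 1#) (λ j → (F ^ˢ k) j * (A ^ˢ j) n) ⟨
        n · 1# * ((F ^ˢ k) ⊚ A) n
          ≈⟨ *-congˡ (trans (⊚-^ˢ A₀≈0 F k n) (^ˢ-cong k FA≋X n)) ⟩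
        n · 1# * (X ^ˢ k) n
          ≈⟨ *-congˡ (trans (sym (S.*-identityʳ (X ^ˢ k) n)) (X^ˢ⊛-+ k one r)) ⟩
        n · 1# * one r
          ≈⟨ θ-power-residue k r ⟨
        (θ (F ^ˢ k) ⊛ W ^ˢ n) n
          ≈⟨ ∑₀-cong n (λ j _ → solve 3 (λ a b c → a :* c :* b := a :* b :* c) refl
               (j · 1#) ((W ^ˢ n) (n ∸ j)) ((F ^ˢ k) j)) ⟩
        ∑₀ n (λ j → j · 1# * (W ^ˢ n) (n ∸ j) * (F ^ˢ k) j) ∎

  -- Compositas as coefficients of powers.

  ·-zero : ∀ n → n · 0# ≈ 0#
  ·-zero zero    = refl
  ·-zero (suc n) = trans (+-identityˡ _) (·-zero n)

  ·1-* : ∀ n x → n · 1# * x ≈ n · x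
  ·1-* n x = trans (×-assoc-* n 1# x) (×-congʳ n (*-identityˡ x))

  sumList-++ : ∀ {a} {B : Set a} (g : B → Carrier) xs ys →
    sumList (List.map g (xs ++ ys)) ≈ sumList (List.map g xs) + sumList (List.map g ys)
  sumList-++ g []       ys = sym (+-identityˡ _)
  sumList-++ g (x ∷ xs) ys = trans (+-congˡ (sumList-++ g xs ys)) (sym (+-assoc _ _ _))

  -- Stated for `applyUpTo f` because the tail of `upTo n` is not of the form `upTo` again; the
  -- induction shifts `f`.
  sumList-concatMap : ∀ {a} {B : Set a} (g : B → Carrier) (h : ℕ → List B) (f : ℕ → ℕ) n →
    sumList (List.map g (concatMap h (List.map suc (applyUpTo f n)))) ≈
    sum {n} (λ i → sumList (List.map g (h (suc (f (toℕ i))))))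
  sumList-concatMap g h f zero    = refl
  sumList-concatMap g h f (suc n) =
    trans (sumList-++ g (h (suc (f 0))) _) (+-congˡ (sumList-concatMap g h (λ i → f (suc i)) n))

  composita-suc : ∀ F n k → composita F n (suc k) ≈ ∑₁ n (λ p → F p * composita F (n ∸ p) k)
  composita-suc F n k = begin
    composita F n (suc k)
      ≡⟨ ≡.cong (λ vs → sumList (List.map weight vs)) (unfold n) ⟩
    sumList (List.map weight (concatMap parts (List.map suc (List.upTo n))))
      ≈⟨ sumList-concatMap weight parts id n ⟩
    ∑₁ n (λ p → sumList (List.map weight (parts p)))
      ≈⟨ sum-cong-≋ {n} (λ i → first-part (suc (toℕ i)) (compositions (n ∸ suc (toℕ i)) k)) ⟩
    ∑₁ n (λ p → F p * composita F (n ∸ p) k) ∎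
    where
    weight : ∀ {k} → Vec ℕ k → Carrier
    weight v = prodVec (Vec.map F v)

    parts : ℕ → List (Vec ℕ (suc k))
    parts p = List.map (p ∷_) (compositions (n ∸ p) k)

    -- The clauses of `compositions` match on n first, so the equation holds by computation only
    -- after a case split on n.
    unfold : ∀ n → compositions n (suc k) ≡
      concatMap (λ p → List.map (p ∷_) (compositions (n ∸ p) k)) (List.map suc (List.upTo n))
    unfold zero    = ≡.refl
    unfold (suc n) = ≡.refl

    first-part : ∀ p (vs : List (Vec ℕ k)) →
      sumList (List.map weight (List.map (p ∷_) vs)) ≈ F p * sumList (List.map weight vs)
    first-part p []       = sym (zeroʳ _)
    first-part p (v ∷ vs) = trans (+-congˡ (first-part p vs)) (sym (distribˡ _ _ _))

  -- Choosing the first part is multiplying by one more F. Parts start at 1 and the index of the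
  -- product at 0; the extra term carries the factor F 0, which vanishes.
  composita≈^ˢ : ∀ {F} → F 0 ≈ 0# → ∀ n k → composita F n k ≈ (F ^ˢ k) n
  composita≈^ˢ F₀≈0 zero    zero = +-identityʳ 1#
  composita≈^ˢ F₀≈0 (suc n) zero = refl
  composita≈^ˢ {F} F₀≈0 n (suc k) = begin
    composita F n (suc k)
      ≈⟨ composita-suc F n k ⟩
    ∑₁ n (λ p → F p * composita F (n ∸ p) k)
      ≈⟨ sum-cong-≋ {n}
           (λ i → *-congˡ {F (suc (toℕ i))} (composita≈^ˢ F₀≈0 (n ∸ suc (toℕ i)) k)) ⟩
    ∑₁ n (λ p → F p * (F ^ˢ k) (n ∸ p))
      ≈⟨ trans (+-congʳ (trans (*-congʳ F₀≈0) (zeroˡ _))) (+-identityˡ _) ⟨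
    (F ⊛ F ^ˢ k) n ∎

  -- Negative binomial series and powers of a reciprocal.

  -- (1 − x)⁻ⁿ
  negBinomial : ℕ → PowerSeries
  negBinomial zero      = one
  negBinomial (suc n) k = ((n ℕ.+ k) C n) · 1#

  negBinomial-head : ∀ n → negBinomial n 0 ≈ 1#
  negBinomial-head zero    = refl
  negBinomial-head (suc n) = begin
    ((n ℕ.+ 0) C n) · 1# ≡⟨ ≡.cong (λ i → (i C n) · 1#) (ℕ.+-identityʳ n) ⟩
    (n C n) · 1#         ≡⟨ ≡.cong (_· 1#) (nCn≡1 n) ⟩
    1# + 0#              ≈⟨ +-identityʳ 1# ⟩
    1#                   ∎

  -- Pascal's rule, which is (1 - x) (1 - x)⁻ⁿ⁻¹ = (1 - x)⁻ⁿ read on the positive coefficients.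
  negBinomial-tail : ∀ n → tail (negBinomial (suc n)) ≋ tail (negBinomial n) ⊕ negBinomial (suc n)
  negBinomial-tail zero    k = sym (+-identityˡ _)
  negBinomial-tail (suc n) k = begin
    (suc (n ℕ.+ suc k) C suc n) · 1#
      ≡⟨ ≡.cong (_· 1#) (nCk+nC[k+1]≡[n+1]C[k+1] (n ℕ.+ suc k) n) ⟨
    (((n ℕ.+ suc k) C n) ℕ.+ ((n ℕ.+ suc k) C suc n)) · 1#
      ≈⟨ ×-homo-+ 1# ((n ℕ.+ suc k) C n) ((n ℕ.+ suc k) C suc n) ⟩
    ((n ℕ.+ suc k) C n) · 1# + ((n ℕ.+ suc k) C suc n) · 1#
      ≡⟨ ≡.cong (λ i → ((n ℕ.+ suc k) C n) · 1# + (i C suc n) · 1#) (ℕ.+-suc n k) ⟩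
    ((n ℕ.+ suc k) C n) · 1# + ((suc n ℕ.+ k) C suc n) · 1# ∎

  module Inverse {U : PowerSeries} (U₀≈1 : U 0 ≈ 1#) where

    E : PowerSeries
    E = ⊖ U ⊕ one

    E₀≈0 : E 0 ≈ 0#
    E₀≈0 = trans (+-congˡ (sym U₀≈1)) (-‿inverseˡ _)

    U⊕E≋one : U ⊕ E ≋ one
    U⊕E≋one = S.trans (S.sym (S.+-assoc U (⊖ U) one))
      (S.trans (S.+-congʳ {one} (S.-‿inverseʳ U)) (S.+-identityˡ one))

    -- Horner's rule and Pascal's recurrence give Q = P + E Q for the two compositions `P` and `Q`.
    -- From U + E = 1 also Q = U Q + E Q, and E Q cancels.
    negBinomial-⊚-suc : ∀ n → U ⊛ (negBinomial (suc n) ⊚ E) ≋ negBinomial n ⊚ E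
    negBinomial-⊚-suc n = SP.+-cancelʳ (E ⊛ Q) (U ⊛ Q) P (≋.begin
      U ⊛ Q ⊕ E ⊛ Q
        ≋.≈⟨ S.distribʳ Q U E ⟨
      (U ⊕ E) ⊛ Q
        ≋.≈⟨ S.trans (S.*-congʳ {Q} U⊕E≋one) (one-⊛ Q) ⟩
      Q
        ≋.≈⟨ ⊚-horner E₀≈0 (negBinomial (suc n)) ⟩
      (negBinomial (suc n) 0 ◃ one) ⊕ E ⊛ (tail (negBinomial (suc n)) ⊚ E)
        ≋.≈⟨ S.+-cong head≋ (S.*-congˡ {E} tail≋) ⟩
      (negBinomial n 0 ◃ one) ⊕ E ⊛ (T ⊕ Q)
        ≋.≈⟨ solveˢ 4 (λ h e t q → h :+ˢ e :*ˢ (t :+ˢ q) :=ˢ h :+ˢ e :*ˢ t :+ˢ e :*ˢ q)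
              S.refl (negBinomial n 0 ◃ one) E T Q ⟩
      (negBinomial n 0 ◃ one) ⊕ E ⊛ T ⊕ E ⊛ Q
        ≋.≈⟨ S.+-congʳ {E ⊛ Q} (⊚-horner E₀≈0 (negBinomial n)) ⟨
      P ⊕ E ⊛ Q ≋.∎)
      where
      module SP = RingProperties S.ring
      P = negBinomial n ⊚ E
      Q = negBinomial (suc n) ⊚ E
      T = tail (negBinomial n) ⊚ E

      head≋ : (negBinomial (suc n) 0 ◃ one) ≋ (negBinomial n 0 ◃ one)
      head≋ i = *-congʳ (trans (negBinomial-head (suc n)) (sym (negBinomial-head n)))

      tail≋ : tail (negBinomial (suc n)) ⊚ E ≋ T ⊕ Q
      tail≋ = S.trans (⊚-congʳ E {tail (negBinomial (suc n))} (negBinomial-tail n))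
                      (⊚-⊕ E (tail (negBinomial n)) (negBinomial (suc n)))

    -- The geometric series in `E`, which is 1/U because U = 1 - E.
    inverse : PowerSeries
    inverse = negBinomial 1 ⊚ E

    inverse-⊛ : U ⊛ inverse ≋ one
    inverse-⊛ = S.trans (negBinomial-⊚-suc 0) (one-⊚ E₀≈0)

    inverse-^ˢ : ∀ n → inverse ^ˢ n ≋ negBinomial n ⊚ E
    inverse-^ˢ zero    = S.sym (one-⊚ E₀≈0)
    inverse-^ˢ (suc n) = ≋.begin
      inverse ⊛ inverse ^ˢ n
        ≋.≈⟨ S.*-congˡ {inverse} (S.trans (inverse-^ˢ n) (S.sym (negBinomial-⊚-suc n))) ⟩
      inverse ⊛ (U ⊛ Q)
        ≋.≈⟨ solveˢ 3 (λ v u q → v :*ˢ (u :*ˢ q) :=ˢ (u :*ˢ v) :*ˢ q) S.refl inverse U Q ⟩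
      (U ⊛ inverse) ⊛ Q
        ≋.≈⟨ S.trans (S.*-congʳ {Q} inverse-⊛) (one-⊛ Q) ⟩
      Q ≋.∎
      where Q = negBinomial (suc n) ⊚ E

  -- Coefficients of (1 - U)ᵏ by the binomial theorem.

  ^ˢ≡^ : ∀ F k → F ^ˢ k ≡ F S.^ k
  ^ˢ≡^ F zero    = ≡.refl
  ^ˢ≡^ F (suc k) = ≡.cong (F ⊛_) (^ˢ≡^ F k)

  ·-coefficient : ∀ k F n → (k S.· F) n ≈ k · F n
  ·-coefficient zero    F n = refl
  ·-coefficient (suc k) F n = +-congˡ (·-coefficient k F n)

  sum-coefficient : ∀ k (t : Fin k → PowerSeries) n → S.sum t n ≈ sum {k} (λ i → t i n)
  sum-coefficient zero    t n = refl
  sum-coefficient (suc k) t n = +-congˡ (sum-coefficient k (λ i → t (Fin.suc i)) n)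

  -- The binomial theorem in `seriesRing`, carried down from its generic power, multiple and sum to
  -- coefficients; -U is treated as the scalar multiple of U by -1.
  [1-U]^-coefficient : ∀ U k r →
    ((⊖ U ⊕ one) ^ˢ k) r ≈ ∑₀ k (λ j → (- 1#) ^ j * ((k C j) · (U ^ˢ j) r))
  [1-U]^-coefficient U k r = begin
    ((⊖ U ⊕ one) ^ˢ k) r
      ≡⟨ ≡.cong (λ P → P r) (^ˢ≡^ (⊖ U ⊕ one) k) ⟩
    ((⊖ U ⊕ one) S.^ k) r
      ≈⟨ Binomial.theorem S.commutativeSemiring k (⊖ U) one r ⟩
    S.sum {suc k} (λ i → term (toℕ i)) r
      ≈⟨ sum-coefficient (suc k) (λ i → term (toℕ i)) r ⟩
    ∑₀ k (λ j → term j r)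
      ≈⟨ ∑₀-cong k (λ j _ → simplify j) ⟩
    ∑₀ k (λ j → (- 1#) ^ j * ((k C j) · (U ^ˢ j) r)) ∎
    where
    term : ℕ → PowerSeries
    term j = (k C j) S.· ((⊖ U) S.^ j ⊛ one S.^ (k ∸ j))

    simplify : ∀ j → term j r ≈ (- 1#) ^ j * ((k C j) · (U ^ˢ j) r)
    simplify j = begin
      term j r
        ≈⟨ ·-coefficient (k C j) ((⊖ U) S.^ j ⊛ one S.^ (k ∸ j)) r ⟩
      (k C j) · ((⊖ U) S.^ j ⊛ one S.^ (k ∸ j)) r
        ≡⟨ ≡.cong₂ (λ P Q → (k C j) · (P ⊛ Q) r) (^ˢ≡^ (⊖ U) j) (^ˢ≡^ one (k ∸ j)) ⟨
      (k C j) · ((⊖ U) ^ˢ j ⊛ one ^ˢ (k ∸ j)) r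
        ≈⟨ ×-congʳ (k C j) (S.trans (S.*-congˡ {(⊖ U) ^ˢ j} (one-^ˢ (k ∸ j))) (S.*-identityʳ ((⊖ U) ^ˢ j)) r) ⟩
      (k C j) · ((⊖ U) ^ˢ j) r
        ≈⟨ ×-congʳ (k C j) (trans (^ˢ-cong j {⊖ U} { - 1# ◃ U} (λ n → sym (-1*x≈-x (U n))) r) (◃-^ˢ (- 1#) U j r)) ⟩
      (k C j) · ((- 1#) ^ j * (U ^ˢ j) r)
        ≈⟨ ×-comm-* (k C j) ((- 1#) ^ j) ((U ^ˢ j) r) ⟨
      (- 1#) ^ j * ((k C j) · (U ^ˢ j) r) ∎

  -- The explicit double sum for the reverse series.

  module Reversion (char0 : CharacteristicZero) {F : PowerSeries} (F₀≈0 : F 0 ≈ 0#)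
                   {u : Carrier} (F₁u≈1 : F 1 * u ≈ 1#) where

    private
      -- Dividing G by F 1 gives `U` the constant term 1 that `Inverse` requires; accordingly 1/G is
      -- `u` times 1/U.
      G U : PowerSeries
      G = tail F
      U = u ◃ G

    open Inverse {U} (trans (*-comm u (F 1)) F₁u≈1) public

    W : PowerSeries
    W = u ◃ inverse

    W⊛G≋one : W ⊛ G ≋ one
    W⊛G≋one n = begin
      ((u ◃ inverse) ⊛ G) n ≈⟨ ◃-⊛ u inverse G n ⟩
      u * (inverse ⊛ G) n   ≈⟨ *-congˡ (⊛-comm inverse G n) ⟩
      u * (G ⊛ inverse) n   ≈⟨ ◃-⊛ u G inverse n ⟨
      (U ⊛ inverse) n       ≈⟨ inverse-⊛ n ⟩
      one n                 ∎

    -- Lagrange inversion divided by n, with Wⁿ = uⁿ (1/U)ⁿ. Both cases of the formula come from it: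
    -- n = m reads the constant term of (1/U)ⁿ, n > m a positive coefficient.
    composita-reverse : ∀ {A} → IsReverse F A → ∀ {n m n⁻¹} → m ≤ n → n · 1# * n⁻¹ ≈ 1# →
      composita A n m ≈ (m · 1# * n⁻¹ * u ^ n) * (inverse ^ˢ n) (n ∸ m)
    composita-reverse {A} rev {n} {m} {n⁻¹} m≤n nn⁻¹≈1 = *-cancelʳ-invertible nn⁻¹≈1 (begin
      composita A n m * n · 1#
        ≈⟨ trans (*-comm _ _) (*-congˡ (composita≈^ˢ (proj₁ rev) n m)) ⟩
      n · 1# * (A ^ˢ m) n
        ≈⟨ lagrange-inversion rev m≤n ⟩
      m · 1# * (W ^ˢ n) (n ∸ m)
        ≈⟨ *-congˡ (◃-^ˢ u inverse n (n ∸ m)) ⟩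
      m · 1# * (u ^ n * (inverse ^ˢ n) (n ∸ m))
        ≈⟨ trans (*-congʳ nn⁻¹≈1) (*-identityˡ _) ⟨
      n · 1# * n⁻¹ * (m · 1# * (u ^ n * (inverse ^ˢ n) (n ∸ m)))
        ≈⟨ solve 5 (λ a b c d e → a :* b :* (c :* (d :* e)) := c :* b :* d :* e :* a) refl
             (n · 1#) n⁻¹ (m · 1#) (u ^ n) ((inverse ^ˢ n) (n ∸ m)) ⟩
      (m · 1# * n⁻¹ * u ^ n) * (inverse ^ˢ n) (n ∸ m) * n · 1# ∎)
      where open Lagrange char0 {F} F₀≈0 {W} W⊛G≋one

    inverse^ˢ-head : ∀ n → (inverse ^ˢ n) 0 ≈ 1#
    inverse^ˢ-head n = begin
      (inverse ^ˢ n) 0        ≈⟨ inverse-^ˢ n 0 ⟩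
      (negBinomial n ⊚ E) 0   ≈⟨ +-identityʳ _ ⟩
      negBinomial n 0 * 1#    ≈⟨ *-identityʳ _ ⟩
      negBinomial n 0         ≈⟨ negBinomial-head n ⟩
      1#                      ∎

    -- The j = 0 term of the binomial expansion is a coefficient of the constant series 1 at a
    -- positive index, hence zero, and the sum starts at j = 1.
    E^ˢ-coefficient : ∀ k {r} → 0 < r → (E ^ˢ k) r ≈
      ∑₁ k (λ j → ((- 1#) ^ j * u ^ j) * ((k C j) · composita F (r ℕ.+ j) j))
    E^ˢ-coefficient k {r@(suc _)} _ = begin
      (E ^ˢ k) r
        ≈⟨ [1-U]^-coefficient U k r ⟩
      1# * ((k C 0) · 0#) + ∑₁ k (λ j → (- 1#) ^ j * ((k C j) · (U ^ˢ j) r))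
        ≈⟨ +-cong (trans (*-identityˡ _) (·-zero (k C 0)))
             (sum-cong-≋ {k} (λ i → term (suc (toℕ i)))) ⟩
      0# + ∑₁ k (λ j → ((- 1#) ^ j * u ^ j) * ((k C j) · composita F (r ℕ.+ j) j))
        ≈⟨ +-identityˡ _ ⟩
      ∑₁ k (λ j → ((- 1#) ^ j * u ^ j) * ((k C j) · composita F (r ℕ.+ j) j)) ∎
      where
      term : ∀ j → (- 1#) ^ j * ((k C j) · (U ^ˢ j) r) ≈
                   ((- 1#) ^ j * u ^ j) * ((k C j) · composita F (r ℕ.+ j) j)
      term j = begin
        (- 1#) ^ j * ((k C j) · (U ^ˢ j) r)
          ≈⟨ *-congˡ (×-congʳ (k C j) (◃-^ˢ u G j r)) ⟩
        (- 1#) ^ j * ((k C j) · (u ^ j * (G ^ˢ j) r))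
          ≈⟨ *-congˡ (×-comm-* (k C j) (u ^ j) ((G ^ˢ j) r)) ⟨
        (- 1#) ^ j * (u ^ j * ((k C j) · (G ^ˢ j) r))
          ≈⟨ *-assoc _ _ _ ⟨
        ((- 1#) ^ j * u ^ j) * ((k C j) · (G ^ˢ j) r)
          ≈⟨ *-congˡ (×-congʳ (k C j) coefficient) ⟩
        ((- 1#) ^ j * u ^ j) * ((k C j) · composita F (r ℕ.+ j) j) ∎
        where
        -- Since F = x G, the index moves up by j in passing from Gʲ to Fʲ.
        coefficient : (G ^ˢ j) r ≈ composita F (r ℕ.+ j) j
        coefficient = begin
          (G ^ˢ j) r                ≈⟨ ^ˢ-+-coefficient F₀≈0 j r ⟨
          (F ^ˢ j) (j ℕ.+ r)        ≡⟨ ≡.cong (F ^ˢ j) (ℕ.+-comm j r) ⟩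
          (F ^ˢ j) (r ℕ.+ j)        ≈⟨ composita≈^ˢ F₀≈0 (r ℕ.+ j) j ⟨
          composita F (r ℕ.+ j) j   ∎

    -- The expansion of (1 - E)⁻ⁿ⁻¹ in powers of E; the bound k ≤ r is built into `_⊚_`, and the
    -- term k = 0 vanishes as r is positive. The exponent is `suc n`, so the binomial carries n
    -- where the theorem has n - 1.
    inverse^ˢ-coefficient : ∀ n {r} → 0 < r → (inverse ^ˢ suc n) r ≈
      ∑₁ r (λ k → ((n ℕ.+ k) C n) ·
        ∑₁ k (λ j → ((- 1#) ^ j * u ^ j) * ((k C j) · composita F (r ℕ.+ j) j)))
    inverse^ˢ-coefficient n {r@(suc _)} 0<r = begin
      (inverse ^ˢ suc n) r
        ≈⟨ inverse-^ˢ (suc n) r ⟩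
      negBinomial (suc n) 0 * 0# + ∑₁ r (λ k → ((n ℕ.+ k) C n) · 1# * (E ^ˢ k) r)
        ≈⟨ trans (+-congʳ (zeroʳ _)) (+-identityˡ _) ⟩
      ∑₁ r (λ k → ((n ℕ.+ k) C n) · 1# * (E ^ˢ k) r)
        ≈⟨ sum-cong-≋ {r} (λ i → term (suc (toℕ i))) ⟩
      ∑₁ r (λ k → ((n ℕ.+ k) C n) ·
        ∑₁ k (λ j → ((- 1#) ^ j * u ^ j) * ((k C j) · composita F (r ℕ.+ j) j))) ∎
      where
      term : ∀ k → ((n ℕ.+ k) C n) · 1# * (E ^ˢ k) r ≈ ((n ℕ.+ k) C n) ·
        ∑₁ k (λ j → ((- 1#) ^ j * u ^ j) * ((k C j) · composita F (r ℕ.+ j) j))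
      term k = trans (·1-* ((n ℕ.+ k) C n) ((E ^ˢ k) r))
                     (×-congʳ ((n ℕ.+ k) C n) (E^ˢ-coefficient k 0<r))

-- The composita of the reverse series in the cases n = m and n > m.

theorem3 :
  ∀ {c ℓ₁ ℓ₂} (K : HeytingField c ℓ₁ ℓ₂) →
  let open HeytingField K
      open Series K in
  (char0 : CharacteristicZero) →
  (F : PowerSeries) → F 0 ≈ 0# → (f₁#0 : F 1 # 0#) →
  (A : PowerSeries) → IsReverse F A →
  (n m : ℕ) (1≤m : 1 ≤ m) (m≤n : m ≤ n) →
  let F₁₁⁻¹ = inv (composita F 1 1) (composita₁₁#0 F f₁#0)
      n⁻¹ = inv (n · 1#) (char0 n (≤-trans 1≤m m≤n)) in
  (n ≡ m → composita A n m ≈ F₁₁⁻¹ ^ n)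
  ×
  (m < n →
    composita A n m ≈
      ((m · 1#) * n⁻¹ * F₁₁⁻¹ ^ n) *
      ∑₁ (n ∸ m) (λ k →
        ((n ℕ.+ k ∸ 1) C (n ∸ 1)) ·
        ∑₁ k (λ j →
          ((- 1#) ^ j * F₁₁⁻¹ ^ j) *
          ((k C j) · composita F (n ∸ m ℕ.+ j) j))))
theorem3 K char0 F F₀≈0 f₁#0 A rev zero (suc _) _ ()
-- With n a successor, the truncated differences n + k ∸ 1 and n ∸ 1 compute to n-1 + k and n-1.
theorem3 K char0 F F₀≈0 f₁#0 A rev n@(suc n-1) m 1≤m m≤n = diagonal , below
  where
  open HeytingField K
  open Series K
  open SeriesAlgebra K
  open SetoidReasoning setoid

  u n⁻¹ : Carrier
  u   = inv (composita F 1 1) (composita₁₁#0 F f₁#0)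
  n⁻¹ = inv (n · 1#) (char0 n (≤-trans 1≤m m≤n))

  F₁u≈1 : F 1 * u ≈ 1#
  F₁u≈1 = trans (*-congʳ (sym (composita₁₁ F))) (inv-inverseʳ (composita F 1 1) (composita₁₁#0 F f₁#0))

  nn⁻¹≈1 : n · 1# * n⁻¹ ≈ 1#
  nn⁻¹≈1 = inv-inverseʳ (n · 1#) (char0 n (≤-trans 1≤m m≤n))

  open Reversion char0 {F} F₀≈0 F₁u≈1

  diagonal : n ≡ m → composita A n m ≈ u ^ n
  diagonal ≡.refl = begin
    composita A n n
      ≈⟨ composita-reverse rev m≤n nn⁻¹≈1 ⟩
    n · 1# * n⁻¹ * u ^ n * (inverse ^ˢ n) (n ∸ n)
      ≡⟨ ≡.cong (λ r → n · 1# * n⁻¹ * u ^ n * (inverse ^ˢ n) r) (ℕ.n∸n≡0 n) ⟩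
    n · 1# * n⁻¹ * u ^ n * (inverse ^ˢ n) 0
      ≈⟨ *-cong (*-congʳ nn⁻¹≈1) (inverse^ˢ-head n) ⟩
    1# * u ^ n * 1#
      ≈⟨ trans (*-identityʳ _) (*-identityˡ _) ⟩
    u ^ n ∎

  below : m < n → composita A n m ≈
    (m · 1# * n⁻¹ * u ^ n) * ∑₁ (n ∸ m) (λ k → ((n-1 ℕ.+ k) C n-1) ·
      ∑₁ k (λ j → ((- 1#) ^ j * u ^ j) * ((k C j) · composita F (n ∸ m ℕ.+ j) j)))
  below m<n = trans (composita-reverse rev m≤n nn⁻¹≈1)
    (*-congˡ (inverse^ˢ-coefficient n-1 (ℕ.m<n⇒0<n∸m m<n)))
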